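{- For every instance of the ATP problem with identical request distributions $\mathcal D_1=\dots=\mathcal D_T=\mathcal D$ of finite support and with $B_0=B=1$, there exists an online algorithm whose expected profit is at least $\tfrac14$ times the expected profit of the optimal offline algorithm.
   Context: ATP (Asymmetric Trading Prophets) problem. A decision maker interacts with $T$ sequentially arriving requests to trade copies of a product. She has capacity $B\ge 1$ (she may hold at most $B$ copies at any time) and starts with an initial inventory of $B_0\in\{0,\dots,B\}$ copies. It is assumed throughout that $T\ge B_0$ and $B\le B_0+T$. At time $t\in\{1,\dots,T\}$ a price tuple $(b_t,s_t)$ is revealed, with $b_t\in[0,+\infty]$ (the cost of buying a copy; $b_t=+\infty$ means buying is impossible) and $s_t\in[0,\infty)$ (the revenue from selling a copy); $(b_t,s_t)$ is drawn from a known distribution $\mathcal D_t$, independently across $t$, while $b_t$ and $s_t$ may be arbitrarily correlated with each other. At time $t$ she takes exactly one action: Buy one copy at price $b_t$ (allowed if she holds at most $B-1$ copies), Sell one copy at price $s_t$ (allowed if she holds at least one copy), or Skip. Profit is total revenue from sales minus total cost of purchases. An online algorithm (possibly randomized) chooses its action at time $t$ knowing only the distributions, the tuples revealed up to and including time $t$, and its past actions. The optimal offline algorithm knows all realized tuples in advance and attains the maximum possible profit for each realization; its expected profit is the expectation of this maximum. -}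

module Defs where

open import Level using (Level; suc; _⊔_)
open import Algebra.Bundles using (CommutativeRing)
import Algebra.Properties.Semiring.Sum as SemiringSum
open import Algebra.Structures using (IsCommutativeRing)
open import Data.Fin.Base using (Fin)
open import Data.List.Base using (List; []; _∷_)
import Data.Nat.Base as ℕ
open import Data.Nat.Base using (ℕ)
import Data.Nat.Properties as ℕ
open import Data.Product.Base using (Σ; _×_; _,_; proj₁; proj₂)
open import Data.Sum.Base using (inj₁; inj₂)
open import Data.Vec.Base using (Vec; []; _∷_)
open import Relation.Binary.Construct.Add.Supremum.NonStrict using (_≤⁺_)
open import Relation.Binary.PropositionalEquality
  using (_≡_; _≢_; refl; sym; trans; subst; cong; cong₂)
open import Relation.Binary.Structures using (IsDecTotalOrder)
open import Relation.Nullary.Construct.Add.Supremum using (_⁺; [_]; ⊤⁺)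
open import Relation.Nullary.Decidable using (Dec; yes; no)
open import Relation.Nullary.Negation using (contradiction)

-- Scalars.  The real numbers are, classically, one such field.
record OrderedField (c ℓ : Level) : Set (suc (c ⊔ ℓ)) where
  infixl 7 _*_
  infixl 6 _+_
  infix  8 -_ _⁻¹
  infix  4 _≤_
  field
    Carrier           : Set c
    _≤_               : Carrier → Carrier → Set ℓ
    _+_ _*_           : Carrier → Carrier → Carrier
    -_                : Carrier → Carrier
    0# 1#             : Carrier
    -- The value of 0# ⁻¹ is unspecified.
    _⁻¹               : Carrier → Carrier
    isCommutativeRing : IsCommutativeRing _≡_ _+_ _*_ -_ 0# 1#
    0≢1               : 0# ≢ 1#
    *-inverseʳ        : ∀ x → x ≢ 0# → x * x ⁻¹ ≡ 1#
    isDecTotalOrder   : IsDecTotalOrder _≡_ _≤_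
    +-monoˡ-≤         : ∀ {x y} z → x ≤ y → x + z ≤ y + z
    *-nonNeg          : ∀ {x y} → 0# ≤ x → 0# ≤ y → 0# ≤ x * y

  commutativeRing : CommutativeRing c c
  commutativeRing = record { isCommutativeRing = isCommutativeRing }

  ¼ : Carrier
  ¼ = (1# + 1# + 1# + 1#) ⁻¹

data Action : Set where
  buy sell skip : Action

module ATP {c ℓ} (F : OrderedField c ℓ) where
  open OrderedField F
  open SemiringSum (CommutativeRing.semiring commutativeRing) using (sum)

  -- Outcomes may repeat and weights may vanish, so this presents exactly the
  -- probability distributions of finite support.
  record FiniteDistribution {a} (A : Set a) : Set (a ⊔ c ⊔ ℓ) where
    field
      size          : ℕ
      outcome       : Fin size → A
      weight        : Fin size → Carrier
      weight-nonNeg : ∀ i → 0# ≤ weight i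
      weight-total  : sum weight ≡ 1#

  𝔼 : ∀ {a} {A : Set a} → FiniteDistribution A → (A → Carrier) → Carrier
  𝔼 D f = sum λ i → weight i * f (outcome i)
    where open FiniteDistribution D

  -- Expectation over independent draws, one from each listed distribution.
  𝔼-indep : ∀ {a} {A : Set a} {n} → Vec (FiniteDistribution A) n →
            (Vec A n → Carrier) → Carrier
  𝔼-indep []       f = f []
  𝔼-indep (D ∷ Ds) f = 𝔼 D λ x → 𝔼-indep Ds λ xs → f (x ∷ xs)

  -- The proofs are irrelevant so that a request carries no information
  -- besides its two prices.
  record Request : Set (c ⊔ ℓ) where
    constructor request
    field
      cost            : Carrier ⁺
      revenue         : Carrier
      .cost-nonNeg    : _≤⁺_ _≤_ [ 0# ] cost
      .revenue-nonNeg : 0# ≤ revenue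
  open Request public using (cost; revenue)

  -- Allowed B h r a : with capacity B and h copies in hand, action a may be
  -- taken on request r.
  data Allowed (B h : ℕ) (r : Request) : Action → Set c where
    buy  : ∀ {b} → h ℕ.< B → cost r ≡ [ b ] → Allowed B h r buy
    sell : 1 ℕ.≤ h → Allowed B h r sell
    skip : Allowed B h r skip

  gain : ∀ {B h r a} → Allowed B h r a → Carrier
  gain         (buy {b} _ _) = - b
  gain {r = r} (sell _)      = revenue r
  gain         skip          = 0#

  after : ℕ → Action → ℕ
  after h buy  = ℕ.suc h
  after h sell = ℕ.pred h
  after h skip = h

  record Instance : Set (c ⊔ ℓ) where
    field
      horizon capacity initial : ℕ
      requests                 : Vec (FiniteDistribution Request) horizon
      1≤capacity               : 1 ℕ.≤ capacity
      initial≤capacity         : initial ℕ.≤ capacity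
      initial≤horizon          : initial ℕ.≤ horizon
      capacity≤initial+horizon : capacity ℕ.≤ initial ℕ.+ horizon

  -- What has been revealed and done so far, most recent step first.
  History : Set (c ⊔ ℓ)
  History = List (Request × Action)

  held : ℕ → History → ℕ
  held B₀ []            = B₀
  held B₀ ((_ , a) ∷ η) = after (held B₀ η) a

  -- A feasible sequence of actions on a fully known sequence of requests.
  data Plan (B h : ℕ) : ∀ {n} → Vec Request n → Set (c ⊔ ℓ) where
    []  : Plan B h []
    _∷_ : ∀ {n r a} {rs : Vec Request n} →
          Allowed B h r a → Plan B (after h a) rs → Plan B h (r ∷ rs)

  profit : ∀ {B h n} {rs : Vec Request n} → Plan B h rs → Carrier
  profit []      = 0#
  profit (m ∷ π) = gain m + profit π

  module _ (I : Instance) where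
    open Instance I

    -- Randomized: a distribution over the currently allowed actions, given the
    -- history and the current request.  (The time is 1 + the history's length;
    -- values on unreachable histories are never used.)
    OnlineAlgorithm : Set (c ⊔ ℓ)
    OnlineAlgorithm = (η : History) (r : Request) →
      FiniteDistribution (Σ Action (Allowed capacity (held initial η) r))

    -- Expectation, over the algorithm's own randomness, of the profit made from
    -- history η onwards when the remaining requests are those given.
    onlineProfit : OnlineAlgorithm → History → ∀ {n} → Vec Request n → Carrier
    onlineProfit α η []       = 0#
    onlineProfit α η (r ∷ rs) = 𝔼 (α η r) λ (a , m) →
      gain m + onlineProfit α ((r , a) ∷ η) rs

    expectedOnlineProfit : OnlineAlgorithm → Carrier
    expectedOnlineProfit α = 𝔼-indep requests (onlineProfit α [])

    record OptimalOfflineAlgorithm : Set (c ⊔ ℓ) where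
      field
        plan    : (rs : Vec Request horizon) → Plan capacity initial rs
        optimal : ∀ rs (π : Plan capacity initial rs) → profit π ≤ profit (plan rs)

    expectedOfflineProfit : OptimalOfflineAlgorithm → Carrier
    expectedOfflineProfit ω = 𝔼-indep requests λ rs → profit (plan rs)
      where open OptimalOfflineAlgorithm ω

  -- Every instance has an optimal offline algorithm, so quantifying over them is
  -- never vacuous; any two have the same profit on each realization.
  private
    open IsDecTotalOrder isDecTotalOrder using ()
      renaming (reflexive to ≤-reflexive; trans to ≤-trans; total to ≤-total)
    open CommutativeRing commutativeRing using (+-comm)

    +-monoʳ-≤ : ∀ {x y} z → x ≤ y → z + x ≤ z + y
    +-monoʳ-≤ {x} {y} z x≤y = subst (_≤ z + y) (+-comm x z)
      (subst (x + z ≤_) (+-comm y z) (+-monoˡ-≤ z x≤y))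

    allowed? : ∀ B h r a → Dec (Allowed B h r a)
    allowed? B h (request ⊤⁺ _ _ _) buy = no λ { (buy _ ()) }
    allowed? B h (request [ b ] _ _ _) buy with h ℕ.<? B
    ... | yes h<B = yes (buy h<B refl)
    ... | no  h≮B = no λ { (buy h<B _) → h≮B h<B }
    allowed? B h r sell with 1 ℕ.≤? h
    ... | yes 1≤h = yes (sell 1≤h)
    ... | no  1≰h = no λ { (sell 1≤h) → 1≰h 1≤h }
    allowed? B h r skip = yes skip

    gain-unique : ∀ {B h r a} (m m′ : Allowed B h r a) → gain m ≡ gain m′
    gain-unique (buy _ p) (buy _ q) with refl ← trans (sym p) q = refl
    gain-unique (sell _)  (sell _)  = refl
    gain-unique skip      skip      = refl

    Best : (B h : ℕ) {n : ℕ} (rs : Vec Request n) → Set (c ⊔ ℓ)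
    Best B h rs = Σ (Plan B h rs) λ π → (π′ : Plan B h rs) → profit π′ ≤ profit π

    module _ {B h n : ℕ} {r : Request} {rs : Vec Request n} (best : ∀ k → Best B k rs) where
      Covers : Plan B h (r ∷ rs) → Action → Set (c ⊔ ℓ)
      Covers π a = (m : Allowed B h r a) (π′ : Plan B (after h a) rs) →
                   profit (m ∷ π′) ≤ profit π

      improve : ∀ a π → Σ (Plan B h (r ∷ rs)) λ π′ →
                profit π ≤ profit π′ × Covers π′ a
      improve a π with allowed? B h r a
      ... | no ¬m = π , ≤-reflexive refl , λ m → contradiction m ¬m
      ... | yes m = pick (≤-total (profit π) (profit new))
        where
        new : Plan B h (r ∷ rs)
        new = m ∷ proj₁ (best (after h a))

        new-covers : Covers new a
        new-covers m′ π′ = ≤-trans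
          (≤-reflexive (cong₂ _+_ (gain-unique m′ m) refl))
          (+-monoʳ-≤ (gain m) (proj₂ (best (after h a)) π′))

        pick : _ → _
        pick (inj₁ π≤new) = new , π≤new , new-covers
        pick (inj₂ new≤π) = π , ≤-reflexive refl ,
          λ m′ π′ → ≤-trans (new-covers m′ π′) new≤π

      step : Best B h (r ∷ rs)
      step with π₀ ← skip ∷ proj₁ (best h)
        with π₁ , _ , c₁ ← improve skip π₀
        with π₂ , ₁≤₂ , c₂ ← improve sell π₁
        with π₃ , ₂≤₃ , c₃ ← improve buy π₂
        = π₃ , λ where
          (_∷_ {a = buy}  m π) → c₃ m π
          (_∷_ {a = sell} m π) → ≤-trans (c₂ m π) ₂≤₃
          (_∷_ {a = skip} m π) → ≤-trans (c₁ m π) (≤-trans ₁≤₂ ₂≤₃)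

    bestPlan : ∀ {B n} (rs : Vec Request n) h → Best B h rs
    bestPlan []       h = [] , λ { [] → ≤-reflexive refl }
    bestPlan (r ∷ rs) h = step (bestPlan rs)

  optimalOffline : (I : Instance) → OptimalOfflineAlgorithm I
  optimalOffline I = record
    { plan    = λ rs → proj₁ (bestPlan rs (Instance.initial I))
    ; optimal = λ rs → proj₂ (bestPlan rs (Instance.initial I))
    }

{-# OPTIONS --safe #-}
-- For a threshold θ ≥ 0 let S = 𝔼 (s - θ)⁺ and C = 𝔼 (θ - b)⁺.  Pricing a copy in
-- hand at θ bounds the expected offline profit by θ + T (S + C).  By piecewise linearity
-- some θ satisfies T S = θ + T C, which turns the bound into 2 T S.  The online
-- algorithm idles with probability ½ and otherwise trades whenever θ makes this
-- profitable.  It earns ½ S per step while holding and ½ C = ½ (S - θ / T) while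
-- empty-handed, plus θ if it ends empty-handed; since the probability of being
-- empty-handed never decreases, its profit is at least ½ T S.
module Submission where

open import Defs
open import Data.Product using (∃)
open import Data.Vec using (replicate)
open import Relation.Binary.PropositionalEquality using (_≡_)

open import Algebra.Bundles using (CommutativeRing; RawRing)
open import Algebra.Solver.Ring.AlmostCommutativeRing
  using (fromCommutativeRing; _-Raw-AlmostCommutative⟶_; Induced-equivalence)
import Algebra.Solver.Ring
import Algebra.Solver.Ring.NaturalCoefficients.Default
import Algebra.Construct.NaturalChoice.Max
import Algebra.Properties.CommutativeMonoid.Mult
import Algebra.Properties.Ring
import Algebra.Properties.Semiring.Mult
import Algebra.Properties.Semiring.Sum
open import Data.Fin.Base using (Fin; zero; suc)
open import Data.List.Base using (_∷_; [])
open import Data.Maybe.Base using (nothing; just)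
open import Data.Nat.Base as ℕ using (ℕ; zero; suc; z≤n; s≤s)
import Data.Nat.Properties as ℕ
open import Data.Product.Base using (Σ; ∃₂; _×_; _,_; proj₁)
open import Data.Sum.Base using (inj₁; inj₂)
open import Data.Vec.Base using (Vec; []; _∷_)
open import Function.Base using (_∘_)
import Level
open import Relation.Binary.Bundles using (TotalOrder)
open import Relation.Binary.Construct.Add.Supremum.NonStrict using (_≤⁺_; [_])
open import Relation.Binary.Definitions using (WeaklyDecidable)
open import Relation.Binary.PropositionalEquality
  using (_≢_; refl; sym; trans; subst; cong; cong₂; module ≡-Reasoning)
import Relation.Binary.Reasoning.PartialOrder
open import Relation.Binary.Structures using (IsDecTotalOrder)
open import Relation.Nullary.Construct.Add.Supremum using ([_]; ⊤⁺)
open import Relation.Nullary.Decidable using (yes; no; recompute)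
open import Relation.Nullary.Negation using (¬_; contradiction)

-- Normalisation in commutative rings with integer coefficients.

-- Coefficients are formal differences of naturals, so that the solver, unlike
-- one with coefficients in the abstract ring, sees that x - x vanishes.
module RingSolver {c} {ℓ} (R : CommutativeRing c ℓ) where
  open CommutativeRing R renaming (refl to ≈-refl; sym to ≈-sym; trans to ≈-trans)
  open Algebra.Properties.Ring ring using (-1*x≈-x; -‿involutive)
  open Algebra.Properties.Semiring.Mult semiring renaming (_×_ to _·_)
  open import Relation.Binary.Reasoning.Setoid setoid
  private
    module S = Algebra.Solver.Ring.NaturalCoefficients.Default commutativeSemiring

    -- Negation is expressed as multiplication by a variable `m`, which puts the morphism laws
    -- within reach of the semiring solver `S`; the relation `m * m ≈ 1#`, which `S` cannot know, is
    -- inserted by hand where two negative parts meet.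
    m : Carrier
    m = - 1#

    mm≈1 : m * m ≈ 1#
    mm≈1 = ≈-trans (-1*x≈-x m) (-‿involutive 1#)

    ⟦_⟧ : ℕ × ℕ → Carrier
    ⟦ a , b ⟧ = a · 1# + m * (b · 1#)

    differences : RawRing _ _
    differences = record
      { Carrier = ℕ × ℕ
      ; _≈_     = _≡_
      ; _+_     = λ (a , b) (c , d) → a ℕ.+ c , b ℕ.+ d
      ; _*_     = λ (a , b) (c , d) → a ℕ.* c ℕ.+ b ℕ.* d , a ℕ.* d ℕ.+ b ℕ.* c
      ; -_      = λ (a , b) → b , a
      ; 0#      = 0 , 0
      ; 1#      = 1 , 0
      }

    ·-homo-*+* : ∀ a b c d → (a ℕ.* c ℕ.+ b ℕ.* d) · 1# ≈
                 (a · 1#) * (c · 1#) + (b · 1#) * (d · 1#)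
    ·-homo-*+* a b c d = ≈-trans (×-homo-+ 1# (a ℕ.* c) (b ℕ.* d))
      (+-cong (×1-homo-* a c) (×1-homo-* b d))

    morphism : differences -Raw-AlmostCommutative⟶ fromCommutativeRing R
    morphism = record
      { ⟦_⟧    = ⟦_⟧
      ; +-homo = λ (a , b) (c , d) → ≈-trans
          (+-cong (×-homo-+ 1# a c) (*-congˡ (×-homo-+ 1# b d)))
          (S.solve 5 (λ A B C D m → (A S.:+ C) S.:+ m S.:* (B S.:+ D) S.:=
            (A S.:+ m S.:* B) S.:+ (C S.:+ m S.:* D)) ≈-refl _ _ _ _ _)
      ; *-homo = λ (a , b) (c , d) → begin
          ⟦ a ℕ.* c ℕ.+ b ℕ.* d , a ℕ.* d ℕ.+ b ℕ.* c ⟧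
            ≈⟨ +-cong (·-homo-*+* a b c d) (*-congˡ (·-homo-*+* a b d c)) ⟩
          a · 1# * c · 1# + b · 1# * d · 1# + m * (a · 1# * d · 1# + b · 1# * c · 1#)
            ≈⟨ +-congʳ (+-congˡ (≈-sym (≈-trans (*-congʳ mm≈1) (*-identityˡ _)))) ⟩
          a · 1# * c · 1# + m * m * (b · 1# * d · 1#) + m * (a · 1# * d · 1# + b · 1# * c · 1#)
            ≈⟨ S.solve 5 (λ A B C D m →
                 A S.:* C S.:+ m S.:* m S.:* (B S.:* D) S.:+ m S.:* (A S.:* D S.:+ B S.:* C) S.:=
                 (A S.:+ m S.:* B) S.:* (C S.:+ m S.:* D)) ≈-refl _ _ _ _ _ ⟩
          ⟦ a , b ⟧ * ⟦ c , d ⟧ ∎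
      ; -‿homo = λ (a , b) → begin
          b · 1# + m * (a · 1#)
            ≈⟨ +-congʳ (≈-sym (≈-trans (*-congʳ mm≈1) (*-identityˡ _))) ⟩
          m * m * (b · 1#) + m * (a · 1#)
            ≈⟨ S.solve 3 (λ A B m → m S.:* m S.:* B S.:+ m S.:* A S.:= m S.:* (A S.:+ m S.:* B))
                 ≈-refl _ _ _ ⟩
          m * ⟦ a , b ⟧ ≈⟨ -1*x≈-x _ ⟩
          - ⟦ a , b ⟧ ∎
      ; 0-homo = ≈-trans (+-identityˡ _) (zeroʳ m)
      ; 1-homo = ≈-trans (+-cong (+-identityʳ 1#) (zeroʳ m)) (+-identityʳ 1#)
      }

    -- Cancellation without subtraction: adding the vanishing term `D + m * D` exposes `a ℕ.+ d`,
    -- which `eq` replaces by `c ℕ.+ b`, and then the vanishing `B + m * B` is dropped.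
    ⟦⟧-cong : ∀ a b c d → a ℕ.+ d ≡ c ℕ.+ b → ⟦ a , b ⟧ ≈ ⟦ c , d ⟧
    ⟦⟧-cong a b c d eq = begin
      A + m * B                       ≈⟨ +-identityʳ _ ⟨
      A + m * B + 0#                  ≈⟨ +-congˡ (cancels D) ⟨
      A + m * B + (D + m * D)         ≈⟨ S.solve 4 (λ A B D m → A S.:+ m S.:* B S.:+ (D S.:+ m S.:* D) S.:=
                                           (A S.:+ D) S.:+ m S.:* (B S.:+ D)) ≈-refl _ _ _ _ ⟩
      (A + D) + m * (B + D)           ≈⟨ +-congʳ (×-homo-+ 1# a d) ⟨
      (a ℕ.+ d) · 1# + m * (B + D)    ≡⟨ cong (λ k → k · 1# + m * (B + D)) eq ⟩
      (c ℕ.+ b) · 1# + m * (B + D)    ≈⟨ +-congʳ (×-homo-+ 1# c b) ⟩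
      (C + B) + m * (B + D)           ≈⟨ S.solve 4 (λ B C D m → (C S.:+ B) S.:+ m S.:* (B S.:+ D) S.:=
                                           C S.:+ m S.:* D S.:+ (B S.:+ m S.:* B)) ≈-refl _ _ _ _ ⟩
      C + m * D + (B + m * B)         ≈⟨ +-congˡ (cancels B) ⟩
      C + m * D + 0#                  ≈⟨ +-identityʳ _ ⟩
      C + m * D                       ∎
      where
      A = a · 1#
      B = b · 1#
      C = c · 1#
      D = d · 1#
      cancels : ∀ x → x + m * x ≈ 0#
      cancels x = ≈-trans (+-congˡ (-1*x≈-x x)) (-‿inverseʳ x)

    _≟_ : WeaklyDecidable (Induced-equivalence morphism)
    (a , b) ≟ (c , d) with a ℕ.+ d ℕ.≟ c ℕ.+ b
    ... | yes eq = just (⟦⟧-cong a b c d eq)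
    ... | no  _  = nothing

  open Algebra.Solver.Ring differences (fromCommutativeRing R) morphism _≟_ public
    using (solve; _:+_; _:*_; _:-_; :-_; _:=_)

-- Arithmetic, multiples, maxima and finite sums in an ordered field.

module OrderedFieldProperties {c ℓ} (F : OrderedField c ℓ) where
  open OrderedField F
  open CommutativeRing commutativeRing public
    using (_-_; +-assoc; +-comm; +-identityˡ; +-identityʳ; -‿inverseʳ;
           *-identityˡ; *-assoc; *-comm; zeroˡ; zeroʳ; distribˡ; distribʳ)
  open IsDecTotalOrder isDecTotalOrder public
    using (_≤?_; _≟_)
    renaming (refl to ≤-refl; reflexive to ≤-reflexive; trans to ≤-trans;
              antisym to ≤-antisym; total to ≤-total)
  open RingSolver commutativeRing public

  totalOrder : TotalOrder _ _ _
  totalOrder = record { isTotalOrder = IsDecTotalOrder.isTotalOrder isDecTotalOrder }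

  module ≤-Reasoning = Relation.Binary.Reasoning.PartialOrder (TotalOrder.poset totalOrder)

  private
    variable
      x y z w : Carrier

  ≰⇒≥ : ¬ x ≤ y → y ≤ x
  ≰⇒≥ {x} {y} x≰y with ≤-total x y
  ... | inj₁ x≤y = contradiction x≤y x≰y
  ... | inj₂ y≤x = y≤x

  +-monoʳ-≤ : ∀ z → x ≤ y → z + x ≤ z + y
  +-monoʳ-≤ {x} {y} z x≤y = subst (_≤ z + y) (+-comm x z)
    (subst (x + z ≤_) (+-comm y z) (+-monoˡ-≤ z x≤y))

  +-mono-≤ : x ≤ y → z ≤ w → x + z ≤ y + w
  +-mono-≤ {y = y} {z} x≤y z≤w = ≤-trans (+-monoˡ-≤ z x≤y) (+-monoʳ-≤ y z≤w)

  +-nonNeg : 0# ≤ x → 0# ≤ y → 0# ≤ x + y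
  +-nonNeg 0≤x 0≤y = ≤-trans (≤-reflexive (sym (+-identityˡ 0#))) (+-mono-≤ 0≤x 0≤y)

  x≤y⇒0≤y-x : x ≤ y → 0# ≤ y - x
  x≤y⇒0≤y-x {x} {y} x≤y = ≤-trans (≤-reflexive (sym (-‿inverseʳ x))) (+-monoˡ-≤ (- x) x≤y)

  0≤y-x⇒x≤y : 0# ≤ y - x → x ≤ y
  0≤y-x⇒x≤y {y} {x} 0≤y-x = begin
    x           ≡⟨ +-identityˡ x ⟨
    0# + x      ≤⟨ +-monoˡ-≤ x 0≤y-x ⟩
    (y - x) + x ≡⟨ solve 2 (λ x y → (y :- x) :+ x := y) refl x y ⟩
    y           ∎
    where open ≤-Reasoning

  x≤y⇒x-y≤0 : x ≤ y → x - y ≤ 0#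
  x≤y⇒x-y≤0 {x} {y} x≤y = ≤-trans (+-monoˡ-≤ (- y) x≤y) (≤-reflexive (-‿inverseʳ y))

  x≤0⇒0≤-x : x ≤ 0# → 0# ≤ - x
  x≤0⇒0≤-x {x} x≤0 = subst (0# ≤_) (+-identityˡ (- x)) (x≤y⇒0≤y-x x≤0)

  x-y≤0⇒x≤y : x - y ≤ 0# → x ≤ y
  x-y≤0⇒x≤y {x} {y} x-y≤0 = 0≤y-x⇒x≤y (subst (0# ≤_)
    (solve 2 (λ x y → :- (x :- y) := y :- x) refl x y) (x≤0⇒0≤-x x-y≤0))

  *-monoˡ-≤ : 0# ≤ z → x ≤ y → z * x ≤ z * y
  *-monoˡ-≤ {z} {x} {y} 0≤z x≤y = 0≤y-x⇒x≤y (subst (0# ≤_)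
    (solve 3 (λ x y z → z :* (y :- x) := z :* y :- z :* x) refl x y z)
    (*-nonNeg 0≤z (x≤y⇒0≤y-x x≤y)))

  0≤1 : 0# ≤ 1#
  0≤1 with ≤-total 0# 1#
  ... | inj₁ 0≤1 = 0≤1
  -- If `1# ≤ 0#`, then `0# - 1#` is nonnegative, and so is its square, which is `1#`.
  ... | inj₂ 1≤0 = subst (0# ≤_) squares (*-nonNeg (x≤y⇒0≤y-x 1≤0) (x≤y⇒0≤y-x 1≤0))
    where
    squares : (0# - 1#) * (0# - 1#) ≡ 1#
    squares = trans
      (cong₂ _*_ (+-identityˡ _) (+-identityˡ _))
      (trans (solve 1 (λ u → (:- u) :* (:- u) := u :* u) refl 1#) (*-identityˡ 1#))

  ⁻¹-nonNeg : x ≢ 0# → 0# ≤ x → 0# ≤ x ⁻¹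
  ⁻¹-nonNeg {x} x≢0 0≤x with ≤-total 0# (x ⁻¹)
  ... | inj₁ 0≤x⁻¹ = 0≤x⁻¹
  ... | inj₂ x⁻¹≤0 = contradiction (≤-antisym 0≤1 1≤0) 0≢1
    where
    1≤0 : 1# ≤ 0#
    1≤0 = ≤-trans (≤-reflexive (sym (*-inverseʳ x x≢0)))
      (≤-trans (*-monoˡ-≤ 0≤x x⁻¹≤0) (≤-reflexive (zeroʳ x)))

  2≢0 : 1# + 1# ≢ 0#
  2≢0 2≡0 = 0≢1 (≤-antisym 0≤1 (subst (1# ≤_) 2≡0
    (subst (_≤ 1# + 1#) (+-identityʳ 1#) (+-monoʳ-≤ 1# 0≤1))))

  ½ : Carrier
  ½ = (1# + 1#) ⁻¹

  0≤½ : 0# ≤ ½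
  0≤½ = ⁻¹-nonNeg 2≢0 (+-nonNeg 0≤1 0≤1)

  ½+½≡1 : ½ + ½ ≡ 1#
  ½+½≡1 = trans (cong₂ _+_ (sym (*-identityˡ ½)) (sym (*-identityˡ ½)))
    (trans (sym (distribʳ ½ 1# 1#)) (*-inverseʳ _ 2≢0))

  ½x+½x≡x : ∀ x → ½ * x + ½ * x ≡ x
  ½x+½x≡x x = trans (sym (distribʳ x ½ ½)) (trans (cong (_* x) ½+½≡1) (*-identityˡ x))

  private
    2# 4# : Carrier
    2# = 1# + 1#
    4# = 1# + 1# + 1# + 1#

    0≤2 : 0# ≤ 2#
    0≤2 = +-nonNeg 0≤1 0≤1

    2+2≡4 : 2# + 2# ≡ 4#
    2+2≡4 = sym (+-assoc 2# 1# 1#)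

    4≢0 : 4# ≢ 0#
    4≢0 4≡0 = 2≢0 (≤-antisym
      (subst (2# ≤_) (trans 2+2≡4 4≡0) (subst (_≤ 2# + 2#) (+-identityʳ 2#) (+-monoʳ-≤ 2# 0≤2)))
      0≤2)

  0≤¼ : 0# ≤ ¼
  0≤¼ = ⁻¹-nonNeg 4≢0 (subst (0# ≤_) 2+2≡4 (+-nonNeg 0≤2 0≤2))

  ¼[x+x]≡½x : ∀ x → ¼ * (x + x) ≡ ½ * x
  ¼[x+x]≡½x x = begin
    ¼ * (x + x)
      -- To the solver `½` and `¼` are unrelated variables, so the factor `2# * ½` is introduced
      -- first and `4# * ¼` is cancelled afterwards.
      ≡⟨ cong (λ y → ¼ * (y + y)) (trans (sym (*-identityˡ x)) (cong (_* x) (sym (*-inverseʳ 2# 2≢0)))) ⟩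
    ¼ * (2# * ½ * x + 2# * ½ * x)
      ≡⟨ solve 4 (λ q t h x → q :* (t :* h :* x :+ t :* h :* x) := (t :+ t) :* q :* (h :* x)) refl ¼ 2# ½ x ⟩
    (2# + 2#) * ¼ * (½ * x)
      ≡⟨ cong (λ y → y * ¼ * (½ * x)) 2+2≡4 ⟩
    4# * ¼ * (½ * x)
      ≡⟨ cong (_* (½ * x)) (*-inverseʳ 4# 4≢0) ⟩
    1# * (½ * x)
      ≡⟨ *-identityˡ _ ⟩
    ½ * x ∎
    where open ≡-Reasoning

  open Algebra.Construct.NaturalChoice.Max totalOrder
    using (_⊔_; x≤x⊔y; x≤y⊔x; x≤y⇒x⊔y≈y; x≤y⇒y⊔x≈y) public

  posPart : Carrier → Carrier
  posPart x = x ⊔ 0#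

  x≤posPart : ∀ x → x ≤ posPart x
  x≤posPart x = x≤x⊔y x 0#

  posPart-nonNeg : ∀ x → 0# ≤ posPart x
  posPart-nonNeg x = x≤y⊔x x 0#

  x≤y⇒posPart≡0 : x ≤ y → posPart (x - y) ≡ 0#
  x≤y⇒posPart≡0 x≤y = x≤y⇒x⊔y≈y (x≤y⇒x-y≤0 x≤y)

  x≤y⇒posPart≡y-x : x ≤ y → posPart (y - x) ≡ y - x
  x≤y⇒posPart≡y-x x≤y = x≤y⇒y⊔x≈y (x≤y⇒0≤y-x x≤y)

  open Algebra.Properties.Semiring.Mult (CommutativeRing.semiring commutativeRing) public
    using () renaming (_×_ to _·_)
  open Algebra.Properties.CommutativeMonoid.Mult (CommutativeRing.+-commutativeMonoid commutativeRing) public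
    using () renaming (×-distrib-+ to ·-distrib-+)

  ·-nonNeg : ∀ n → 0# ≤ x → 0# ≤ n · x
  ·-nonNeg zero    0≤x = ≤-refl
  ·-nonNeg (suc n) 0≤x = +-nonNeg 0≤x (·-nonNeg n 0≤x)

  ·-nonPos : ∀ n → x ≤ 0# → n · x ≤ 0#
  ·-nonPos zero    x≤0 = ≤-refl
  ·-nonPos (suc n) x≤0 = ≤-trans (+-mono-≤ x≤0 (·-nonPos n x≤0)) (≤-reflexive (+-identityˡ 0#))

  ·-monoˡ-≤ : ∀ {m n} → 0# ≤ x → m ℕ.≤ n → m · x ≤ n · x
  ·-monoˡ-≤ {n = n} 0≤x z≤n       = ·-nonNeg n 0≤x
  ·-monoˡ-≤         0≤x (s≤s m≤n) = +-monoʳ-≤ _ (·-monoˡ-≤ 0≤x m≤n)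

  -- Only the sign of `n · x` is known. If `x` is nonpositive, then `m · x ≤ 0# ≤ n · x`; otherwise
  -- multiples grow. This avoids a division by `n`.
  ·-prefix-≤ : ∀ {m n} → m ℕ.≤ n → 0# ≤ n · x → m · x ≤ n · x
  ·-prefix-≤ {x = x} {m} m≤n 0≤nx with ≤-total 0# x
  ... | inj₁ 0≤x = ·-monoˡ-≤ 0≤x m≤n
  ... | inj₂ x≤0 = ≤-trans (·-nonPos m x≤0) 0≤nx

  open Algebra.Properties.Semiring.Sum (CommutativeRing.semiring commutativeRing) public
    using (sum; sum-cong-≗; ∑-distrib-+; ∑-comm; *-distribˡ-sum; *-distribʳ-sum)

  sum-mono : ∀ {n} {f g : Fin n → Carrier} → (∀ i → f i ≤ g i) → sum f ≤ sum g
  sum-mono {zero}  f≤g = ≤-refl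
  sum-mono {suc n} f≤g = +-mono-≤ (f≤g zero) (sum-mono (f≤g ∘ suc))

  upperBound : ∀ {n} (f : Fin n → Carrier) → ∃ λ u → 0# ≤ u × (∀ i → f i ≤ u)
  upperBound {zero}  f = 0# , ≤-refl , λ ()
  upperBound {suc n} f with upperBound (f ∘ suc)
  ... | u , 0≤u , f≤u = f zero ⊔ u , ≤-trans 0≤u (x≤y⊔x (f zero) u) , λ where
    zero    → x≤x⊔y (f zero) u
    (suc i) → ≤-trans (f≤u i) (x≤y⊔x (f zero) u)

-- Piecewise affine functions and their roots.

module PiecewiseAffineFunctions {c ℓ} (F : OrderedField c ℓ) where
  open OrderedField F
  open OrderedFieldProperties F

  AffineOn : (Carrier → Carrier) → Carrier → Carrier → Set (c Level.⊔ ℓ)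
  AffineOn f x y = ∃₂ λ α β → ∀ z → x ≤ z → z ≤ y → f z ≡ α + β * z

  record SignChange (g : Carrier → Carrier) (x y : Carrier) : Set (c Level.⊔ ℓ) where
    constructor signChange
    field
      x≤y  : x ≤ y
      gx≤0 : g x ≤ 0#
      0≤gy : 0# ≤ g y

  record AffinePiece (f g : Carrier → Carrier) (x y : Carrier) : Set (c Level.⊔ ℓ) where
    constructor affinePiece
    field
      {lo hi} : Carrier
      x≤lo    : x ≤ lo
      hi≤y    : hi ≤ y
      change  : SignChange g lo hi
      affine  : AffineOn f lo hi

  -- As the sign change of g is kept for an arbitrary g, this property passes to
  -- sums by shrinking the interval once for each summand; taking g = f yields
  -- the intermediate value theorem without any completeness of the field.
  PiecewiseAffine : (Carrier → Carrier) → Set (c Level.⊔ ℓ)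
  PiecewiseAffine f = ∀ g {x y} → SignChange g x y → AffinePiece f g x y

  affine-piecewiseAffine : ∀ {f} α β → (∀ z → f z ≡ α + β * z) → PiecewiseAffine f
  affine-piecewiseAffine α β f≡ g s = affinePiece ≤-refl ≤-refl s (α , β , λ z _ _ → f≡ z)

  const-piecewiseAffine : ∀ k → PiecewiseAffine (λ _ → k)
  const-piecewiseAffine k = affine-piecewiseAffine k 0# λ z →
    sym (trans (cong (k +_) (zeroˡ z)) (+-identityʳ k))

  id-piecewiseAffine : PiecewiseAffine (λ z → z)
  id-piecewiseAffine = affine-piecewiseAffine 0# 1# λ z →
    sym (trans (+-identityˡ _) (*-identityˡ z))

  +-piecewiseAffine : ∀ {f h} → PiecewiseAffine f → PiecewiseAffine h →
                      PiecewiseAffine (λ z → f z + h z)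
  +-piecewiseAffine F H g s with F g s
  ... | affinePiece x≤x₁ y₁≤y s₁ (α , β , f≡) with H g s₁
  ... | affinePiece x₁≤x₂ y₂≤y₁ s₂ (γ , δ , h≡) =
    affinePiece (≤-trans x≤x₁ x₁≤x₂) (≤-trans y₂≤y₁ y₁≤y) s₂ (α + γ , β + δ , λ z l u →
      trans (cong₂ _+_ (f≡ z (≤-trans x₁≤x₂ l) (≤-trans u y₂≤y₁)) (h≡ z l u))
        (solve 5 (λ α β γ δ z → (α :+ β :* z) :+ (γ :+ δ :* z) := (α :+ γ) :+ (β :+ δ) :* z)
          refl α β γ δ z))

  *-piecewiseAffine : ∀ {f} k → PiecewiseAffine f → PiecewiseAffine (λ z → k * f z)
  *-piecewiseAffine k F g s with F g s
  ... | affinePiece x≤x₁ y₁≤y s₁ (α , β , f≡) =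
    affinePiece x≤x₁ y₁≤y s₁ (k * α , k * β , λ z l u →
      trans (cong (k *_) (f≡ z l u))
        (solve 4 (λ k α β z → k :* (α :+ β :* z) := k :* α :+ k :* β :* z) refl k α β z))

  ·-piecewiseAffine : ∀ {f} n → PiecewiseAffine f → PiecewiseAffine (λ z → n · f z)
  ·-piecewiseAffine zero    F = const-piecewiseAffine 0#
  ·-piecewiseAffine (suc n) F = +-piecewiseAffine F (·-piecewiseAffine n F)

  sum-piecewiseAffine : ∀ {n} {f : Fin n → Carrier → Carrier} →
    (∀ i → PiecewiseAffine (f i)) → PiecewiseAffine (λ z → sum λ i → f i z)
  sum-piecewiseAffine {zero}  F = const-piecewiseAffine 0#
  sum-piecewiseAffine {suc n} F = +-piecewiseAffine (F zero) (sum-piecewiseAffine (F ∘ suc))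

  -- If the breakpoint `a` lies inside the interval, the sign of `g a` tells which half still
  -- carries the sign change of `g`, and `f` is affine on either half.
  kink-piecewiseAffine : ∀ {f} a α β γ δ →
    (∀ z → z ≤ a → f z ≡ α + β * z) → (∀ z → a ≤ z → f z ≡ γ + δ * z) → PiecewiseAffine f
  kink-piecewiseAffine a α β γ δ left right g {x} {y} s@(signChange x≤y gx≤0 0≤gy)
    with ≤-total a x | ≤-total y a
  ... | inj₁ a≤x | _ = affinePiece ≤-refl ≤-refl s (γ , δ , λ z l _ → right z (≤-trans a≤x l))
  ... | inj₂ x≤a | inj₁ y≤a = affinePiece ≤-refl ≤-refl s (α , β , λ z _ u → left z (≤-trans u y≤a))
  ... | inj₂ x≤a | inj₂ a≤y with ≤-total (g a) 0#
  ... | inj₁ ga≤0 = affinePiece x≤a ≤-refl (signChange a≤y ga≤0 0≤gy) (γ , δ , λ z l _ → right z l)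
  ... | inj₂ 0≤ga = affinePiece ≤-refl a≤y (signChange x≤a gx≤0 0≤ga) (α , β , λ z _ u → left z u)

  posPart[z-a]-piecewiseAffine : ∀ a → PiecewiseAffine (λ z → posPart (z - a))
  posPart[z-a]-piecewiseAffine a = kink-piecewiseAffine a 0# 0# (- a) 1#
    (λ z z≤a → trans (x≤y⇒posPart≡0 z≤a) (sym (trans (+-identityˡ _) (zeroˡ z))))
    (λ z a≤z → trans (x≤y⇒posPart≡y-x a≤z)
      (trans (+-comm z (- a)) (cong (- a +_) (sym (*-identityˡ z)))))

  posPart[a-z]-piecewiseAffine : ∀ a → PiecewiseAffine (λ z → posPart (a - z))
  posPart[a-z]-piecewiseAffine a = kink-piecewiseAffine a a (- 1#) 0# 0#
    (λ z z≤a → trans (x≤y⇒posPart≡y-x z≤a)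
      (cong (a +_) (trans (cong -_ (sym (*-identityˡ z)))
        (solve 2 (λ u z → :- (u :* z) := (:- u) :* z) refl 1# z))))
    (λ z a≤z → trans (x≤y⇒posPart≡0 a≤z) (sym (trans (+-identityˡ _) (zeroˡ z))))

  -- For positive slope the root is `- (α * β ⁻¹)`, and dividing the two sign conditions by `β`
  -- places it between `x` and `y`. For zero or negative slope the value at `x` is at least the
  -- value at `y`, so the signs force a root at `x` itself.
  affine-root : ∀ {x y} α β → x ≤ y → α + β * x ≤ 0# → 0# ≤ α + β * y →
                ∃ λ z → x ≤ z × z ≤ y × α + β * z ≡ 0#
  affine-root {x} {y} α β x≤y fx≤0 0≤fy with β ≟ 0# | ≤-total 0# β
  ... | yes refl | _ = x , ≤-refl , x≤y , ≤-antisym fx≤0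
    (subst (0# ≤_) (cong (α +_) (trans (zeroˡ y) (sym (zeroˡ x)))) 0≤fy)
  ... | no β≢0 | inj₂ β≤0 = x , ≤-refl , x≤y , ≤-antisym fx≤0 (≤-trans 0≤fy (0≤y-x⇒x≤y
    (subst (0# ≤_)
      (solve 4 (λ α β x y → (y :- x) :* (:- β) := (α :+ β :* x) :- (α :+ β :* y)) refl α β x y)
      (*-nonNeg (x≤y⇒0≤y-x x≤y) (x≤0⇒0≤-x β≤0)))))
  ... | no β≢0 | inj₁ 0≤β = z , 0≤y-x⇒x≤y 0≤z-x , 0≤y-x⇒x≤y 0≤y-z , fz≡0
    where
    z = - (α * β ⁻¹)

    0≤β⁻¹ : 0# ≤ β ⁻¹
    0≤β⁻¹ = ⁻¹-nonNeg β≢0 0≤β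

    1*≡ : ∀ w → β * β ⁻¹ * w ≡ w
    1*≡ w = trans (cong (_* w) (*-inverseʳ β β≢0)) (*-identityˡ w)

    0≤z-x : 0# ≤ z - x
    0≤z-x = subst (0# ≤_)
      (trans (solve 4 (λ α β i x → i :* (:- (α :+ β :* x)) := :- (α :* i) :- β :* i :* x)
          refl α β (β ⁻¹) x)
        (cong (λ w → z - w) (1*≡ x)))
      (*-nonNeg 0≤β⁻¹ (x≤0⇒0≤-x fx≤0))

    0≤y-z : 0# ≤ y - z
    0≤y-z = subst (0# ≤_)
      (trans (solve 4 (λ α β i y → i :* (α :+ β :* y) := β :* i :* y :- (:- (α :* i)))
          refl α β (β ⁻¹) y)
        (cong (_- z) (1*≡ y)))
      (*-nonNeg 0≤β⁻¹ 0≤fy)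

    fz≡0 : α + β * z ≡ 0#
    fz≡0 = trans (solve 3 (λ α β i → α :+ β :* (:- (α :* i)) := α :- β :* i :* α) refl α β (β ⁻¹))
      (trans (cong (λ w → α - w) (1*≡ α)) (-‿inverseʳ α))

  piecewiseAffine-root : ∀ {f x y} → PiecewiseAffine f → SignChange f x y →
                         ∃ λ z → x ≤ z × f z ≡ 0#
  piecewiseAffine-root {f} F s with F f s
  ... | affinePiece {lo} {hi} x≤lo hi≤y (signChange lo≤hi flo≤0 0≤fhi) (α , β , f≡)
    with affine-root α β lo≤hi (subst (_≤ 0#) (f≡ lo ≤-refl lo≤hi) flo≤0)
                               (subst (0# ≤_) (f≡ hi lo≤hi ≤-refl) 0≤fhi)
  ... | z , lo≤z , z≤hi , αβz≡0 = z , ≤-trans x≤lo lo≤z , trans (f≡ z lo≤z z≤hi) αβz≡0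

-- Expectations over finite distributions and independent draws.

module Expectation {c ℓ} (F : OrderedField c ℓ) where
  open OrderedField F
  open OrderedFieldProperties F
  open ATP F
  open FiniteDistribution
  open ≡-Reasoning

  private
    variable
      a b : Level.Level
      A : Set a
      B : Set b

  𝔼-cong : ∀ (D : FiniteDistribution A) {f g} → (∀ x → f x ≡ g x) → 𝔼 D f ≡ 𝔼 D g
  𝔼-cong D f≗g = sum-cong-≗ λ i → cong (weight D i *_) (f≗g (outcome D i))

  𝔼-mono : ∀ (D : FiniteDistribution A) {f g} → (∀ x → f x ≤ g x) → 𝔼 D f ≤ 𝔼 D g
  𝔼-mono D f≤g = sum-mono λ i → *-monoˡ-≤ (weight-nonNeg D i) (f≤g (outcome D i))

  𝔼-const : ∀ (D : FiniteDistribution A) k → 𝔼 D (λ _ → k) ≡ k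
  𝔼-const D k = trans (sym (*-distribʳ-sum k (weight D)))
    (trans (cong (_* k) (weight-total D)) (*-identityˡ k))

  𝔼-+ : ∀ (D : FiniteDistribution A) f g → 𝔼 D (λ x → f x + g x) ≡ 𝔼 D f + 𝔼 D g
  𝔼-+ D f g = trans (sum-cong-≗ λ i → distribˡ (weight D i) (f (outcome D i)) (g (outcome D i)))
    (∑-distrib-+ (λ i → weight D i * f (outcome D i)) (λ i → weight D i * g (outcome D i)))

  𝔼-*ʳ : ∀ (D : FiniteDistribution A) f k → 𝔼 D (λ x → f x * k) ≡ 𝔼 D f * k
  𝔼-*ʳ D f k = trans (sum-cong-≗ λ i → sym (*-assoc (weight D i) (f (outcome D i)) k))
    (sym (*-distribʳ-sum k (λ i → weight D i * f (outcome D i))))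

  𝔼-const-+ : ∀ (D : FiniteDistribution A) k f → 𝔼 D (λ x → k + f x) ≡ k + 𝔼 D f
  𝔼-const-+ D k f = trans (𝔼-+ D (λ _ → k) f) (cong (_+ 𝔼 D f) (𝔼-const D k))

  𝔼-swap : ∀ (D : FiniteDistribution A) (E : FiniteDistribution B) (f : A → B → Carrier) →
           𝔼 D (λ x → 𝔼 E (f x)) ≡ 𝔼 E (λ y → 𝔼 D (λ x → f x y))
  𝔼-swap D E f = begin
    (sum λ i → u i * (sum λ j → w j * g i j))
      ≡⟨ sum-cong-≗ (λ i → *-distribˡ-sum (u i) (λ j → w j * g i j)) ⟩
    (sum λ i → sum λ j → u i * (w j * g i j))
      ≡⟨ ∑-comm (λ i j → u i * (w j * g i j)) ⟩
    (sum λ j → sum λ i → u i * (w j * g i j))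
      ≡⟨ sum-cong-≗ (λ j → sum-cong-≗ λ i →
           solve 3 (λ u w g → u :* (w :* g) := w :* (u :* g)) refl (u i) (w j) (g i j)) ⟩
    (sum λ j → sum λ i → w j * (u i * g i j))
      ≡⟨ sum-cong-≗ (λ j → *-distribˡ-sum (w j) (λ i → u i * g i j)) ⟨
    (sum λ j → w j * (sum λ i → u i * g i j)) ∎
    where
    u = weight D
    w = weight E
    g = λ i j → f (outcome D i) (outcome E j)

  𝔼-indep-mono : ∀ {n} (Ds : Vec (FiniteDistribution A) n) {f g} →
                 (∀ xs → f xs ≤ g xs) → 𝔼-indep Ds f ≤ 𝔼-indep Ds g
  𝔼-indep-mono []       f≤g = f≤g []
  𝔼-indep-mono (D ∷ Ds) f≤g = 𝔼-mono D λ x → 𝔼-indep-mono Ds λ xs → f≤g (x ∷ xs)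

  𝔼-indep-const-+ : ∀ {n} (Ds : Vec (FiniteDistribution A) n) k f →
                    𝔼-indep Ds (λ xs → k + f xs) ≡ k + 𝔼-indep Ds f
  𝔼-indep-const-+ []       k f = refl
  𝔼-indep-const-+ (D ∷ Ds) k f = trans
    (𝔼-cong D λ x → 𝔼-indep-const-+ Ds k (λ xs → f (x ∷ xs)))
    (𝔼-const-+ D k λ x → 𝔼-indep Ds (λ xs → f (x ∷ xs)))

  -- In `onlineProfit` the coin of the current step lies inside the expectation over all later
  -- requests. Exchanging the two lets the expected profit be computed step by step.
  𝔼-indep-swap : ∀ {n} (Ds : Vec (FiniteDistribution A) n) (E : FiniteDistribution B)
                 (f : Vec A n → B → Carrier) →
                 𝔼-indep Ds (λ xs → 𝔼 E (f xs)) ≡ 𝔼 E (λ y → 𝔼-indep Ds (λ xs → f xs y))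
  𝔼-indep-swap []       E f = refl
  𝔼-indep-swap (D ∷ Ds) E f = trans
    (𝔼-cong D λ x → 𝔼-indep-swap Ds E (λ xs → f (x ∷ xs)))
    (𝔼-swap D E λ x y → 𝔼-indep Ds (λ xs → f (x ∷ xs) y))

  total : ∀ {n} → (A → Carrier) → Vec A n → Carrier
  total f []       = 0#
  total f (x ∷ xs) = f x + total f xs

  𝔼-indep-total : ∀ n (D : FiniteDistribution A) f →
                  𝔼-indep (replicate n D) (total f) ≡ n · 𝔼 D f
  𝔼-indep-total zero    D f = refl
  𝔼-indep-total (suc n) D f = begin
    𝔼 D (λ x → 𝔼-indep (replicate n D) (λ xs → f x + total f xs))
      ≡⟨ 𝔼-cong D (λ x → 𝔼-indep-const-+ (replicate n D) (f x) (total f)) ⟩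
    𝔼 D (λ x → f x + 𝔼-indep (replicate n D) (total f))
      ≡⟨ 𝔼-+ D f (λ _ → 𝔼-indep (replicate n D) (total f)) ⟩
    𝔼 D f + 𝔼 D (λ _ → 𝔼-indep (replicate n D) (total f))
      ≡⟨ cong (𝔼 D f +_) (trans (𝔼-const D _) (𝔼-indep-total n D f)) ⟩
    𝔼 D f + n · 𝔼 D f ∎

  fairCoin : A → A → FiniteDistribution A
  fairCoin x y = record
    { size          = 2
    ; outcome       = λ { zero → x ; (suc zero) → y }
    ; weight        = λ _ → ½
    ; weight-nonNeg = λ _ → 0≤½
    ; weight-total  = trans (cong (½ +_) (+-identityʳ ½)) ½+½≡1
    }

  𝔼-fairCoin : ∀ (x y : A) (f : A → Carrier) → 𝔼 (fairCoin x y) f ≡ ½ * f x + ½ * f y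
  𝔼-fairCoin x y f = cong (½ * f x +_) (+-identityʳ (½ * f y))

-- Surpluses relative to a threshold, and the balanced threshold.

module ThresholdTrading {c ℓ} (F : OrderedField c ℓ) where
  open OrderedField F
  open OrderedFieldProperties F
  open PiecewiseAffineFunctions F
  open ATP F
  open Expectation F
  open FiniteDistribution

  -- Best gains over skipping from a sale and from a purchase when each copy is priced at `θ`.
  -- `surplus` adds the two, although only one can be realised per request, so that its expectation
  -- splits into a selling and a buying part.
  sellSurplus buySurplus surplus : Carrier → Request → Carrier
  sellSurplus θ r = posPart (revenue r - θ)
  buySurplus θ (request ⊤⁺ _ _ _)    = 0#
  buySurplus θ (request [ b ] _ _ _) = posPart (θ - b)
  surplus θ r = sellSurplus θ r + buySurplus θ r

  buySurplus-piecewiseAffine : ∀ r → PiecewiseAffine (λ θ → buySurplus θ r)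
  buySurplus-piecewiseAffine (request ⊤⁺ _ _ _)    = const-piecewiseAffine 0#
  buySurplus-piecewiseAffine (request [ b ] _ _ _) = posPart[z-a]-piecewiseAffine b

  buySurplus-nonNeg : ∀ θ r → 0# ≤ buySurplus θ r
  buySurplus-nonNeg θ (request ⊤⁺ _ _ _)    = ≤-refl
  buySurplus-nonNeg θ (request [ b ] _ _ _) = posPart-nonNeg (θ - b)

  buySurplus-0 : ∀ r → buySurplus 0# r ≡ 0#
  buySurplus-0 (request ⊤⁺ _ _ _) = refl
  -- The proof stored in a request is irrelevant; decidability of the order makes it usable.
  buySurplus-0 (request [ b ] _ 0≤b _) =
    x≤y⇒posPart≡0 (recompute (0# ≤? b) (finite 0≤b))
    where
    finite : _≤⁺_ _≤_ [ 0# ] [ b ] → 0# ≤ b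
    finite [ 0≤b ] = 0≤b

  𝔼-piecewiseAffine : ∀ (D : FiniteDistribution Request) {f : Carrier → Request → Carrier} →
    (∀ r → PiecewiseAffine (λ θ → f θ r)) → PiecewiseAffine (λ θ → 𝔼 D (f θ))
  𝔼-piecewiseAffine D F = sum-piecewiseAffine λ i → *-piecewiseAffine (weight D i) (F (outcome D i))

  0≤𝔼 : ∀ (D : FiniteDistribution Request) f → (∀ r → 0# ≤ f r) → 0# ≤ 𝔼 D f
  0≤𝔼 D f 0≤f = subst (_≤ 𝔼 D f) (𝔼-const D 0#) (𝔼-mono D 0≤f)

  module _ (D : FiniteDistribution Request) (T : ℕ) where
    -- Its roots are the balanced thresholds. Subtraction is written as a factor `- 1#` to fit the
    -- closure rules for piecewise affine functions.
    imbalance : Carrier → Carrier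
    imbalance θ = θ + T · 𝔼 D (buySurplus θ) + (- 1#) * T · 𝔼 D (sellSurplus θ)

    imbalance≡ : ∀ θ → imbalance θ ≡ (θ + T · 𝔼 D (buySurplus θ)) - T · 𝔼 D (sellSurplus θ)
    imbalance≡ θ = cong (θ + T · 𝔼 D (buySurplus θ) +_)
      (Algebra.Properties.Ring.-1*x≈-x (CommutativeRing.ring commutativeRing) _)

    imbalance-piecewiseAffine : PiecewiseAffine imbalance
    imbalance-piecewiseAffine = +-piecewiseAffine
      (+-piecewiseAffine id-piecewiseAffine
        (·-piecewiseAffine T (𝔼-piecewiseAffine D buySurplus-piecewiseAffine)))
      (*-piecewiseAffine (- 1#) (·-piecewiseAffine T
        (𝔼-piecewiseAffine D λ r → posPart[a-z]-piecewiseAffine (revenue r))))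

    -- Costs are nonnegative, so buying has no surplus at threshold zero, while selling has a
    -- nonnegative one.
    imbalance-0≤0 : imbalance 0# ≤ 0#
    imbalance-0≤0 = subst (_≤ 0#) (sym (imbalance≡ 0#)) (x≤y⇒x-y≤0 (begin
      0# + T · 𝔼 D (buySurplus 0#) ≡⟨ +-identityˡ _ ⟩
      T · 𝔼 D (buySurplus 0#)      ≡⟨ cong (T ·_) (trans (𝔼-cong D buySurplus-0) (𝔼-const D 0#)) ⟩
      T · 0#                       ≤⟨ ·-nonPos T ≤-refl ⟩
      0#                           ≤⟨ ·-nonNeg T (0≤𝔼 D _ λ r → posPart-nonNeg (revenue r - 0#)) ⟩
      T · 𝔼 D (sellSurplus 0#)     ∎))
      where open ≤-Reasoning

    -- No sale has a surplus over a threshold that dominates every revenue in the support.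
    0≤imbalance : ∀ {M} → 0# ≤ M → (∀ i → revenue (outcome D i) ≤ M) → 0# ≤ imbalance M
    0≤imbalance {M} 0≤M rev≤M = subst (0# ≤_) (sym (imbalance≡ M)) (x≤y⇒0≤y-x (begin
      T · 𝔼 D (sellSurplus M)      ≡⟨ cong (T ·_) (trans
                                        -- `M` bounds revenues only on the listed outcomes, so the
                                        -- summands are compared index by index rather than by
                                        -- `𝔼-cong`.
                                        (sum-cong-≗ λ i → cong (weight D i *_) (x≤y⇒posPart≡0 (rev≤M i)))
                                        (𝔼-const D 0#)) ⟩
      T · 0#                       ≤⟨ ·-nonPos T ≤-refl ⟩
      0#                           ≤⟨ +-nonNeg 0≤M (·-nonNeg T (0≤𝔼 D _ (buySurplus-nonNeg M))) ⟩
      M + T · 𝔼 D (buySurplus M)   ∎))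
      where open ≤-Reasoning

    balanced-threshold : ∃ λ θ → 0# ≤ θ ×
      T · 𝔼 D (sellSurplus θ) ≡ θ + T · 𝔼 D (buySurplus θ)
    balanced-threshold =
      let M , 0≤M , rev≤M = upperBound (revenue ∘ outcome D)
          θ , 0≤θ , root = piecewiseAffine-root imbalance-piecewiseAffine
            (signChange 0≤M imbalance-0≤0 (0≤imbalance 0≤M rev≤M))
      in θ , 0≤θ , ≤-antisym
        (0≤y-x⇒x≤y (≤-reflexive (sym (trans (sym (imbalance≡ θ)) root))))
        (x-y≤0⇒x≤y (≤-reflexive (trans (sym (imbalance≡ θ)) root)))

-- Strategies that depend only on the inventory.

module MarkovStrategies {c ℓ} (F : OrderedField c ℓ) where
  open OrderedField F
  open OrderedFieldProperties F
  open ATP F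
  open Expectation F

  Strategy : ℕ → Set _
  Strategy B = ∀ h r → FiniteDistribution (Σ Action (Allowed B h r))

  module _ {B : ℕ} (σ : Strategy B) (D : FiniteDistribution Request) where
    -- The dynamic programming recursion for a fixed strategy: `n` counts the remaining requests and
    -- `h` the copies in hand.
    value : ℕ → ℕ → Carrier
    value zero    h = 0#
    value (suc n) h = 𝔼 D λ r → 𝔼 (σ h r) λ (a , m) → gain m + value n (after h a)

  -- Induction on the remaining requests. Since `held` of an extended history computes to `after` of
  -- the old inventory, the induction hypothesis speaks of exactly the state that `value` recurses
  -- on.
  𝔼-onlineProfit : ∀ (I : Instance) (σ : Strategy (Instance.capacity I)) D n η →
    𝔼-indep (replicate n D) (onlineProfit I (λ η → σ (held (Instance.initial I) η)) η) ≡
    value σ D n (held (Instance.initial I) η)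
  𝔼-onlineProfit I σ D zero    η = refl
  𝔼-onlineProfit I σ D (suc n) η = 𝔼-cong D λ r → trans
    (𝔼-indep-swap (replicate n D) (σ (held initial η) r)
      (λ rs (a , m) → gain m + onlineProfit I α ((r , a) ∷ η) rs))
    (𝔼-cong (σ (held initial η) r) λ (a , m) → trans
      (𝔼-indep-const-+ (replicate n D) (gain m) (onlineProfit I α ((r , a) ∷ η)))
      (cong (gain m +_) (𝔼-onlineProfit I σ D n ((r , a) ∷ η))))
    where
    open Instance I using (initial)
    α : OnlineAlgorithm I
    α η = σ (held initial η)

-- An upper bound on the offline profit from pricing the inventory.

module OfflineBound {c ℓ} (F : OrderedField c ℓ) (θ : OrderedField.Carrier F) where
  open OrderedField F
  open OrderedFieldProperties F
  open ATP F
  open Expectation F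
  open ThresholdTrading F

  -- The potential `h · θ` is the worth of the inventory at price `θ`. The gain of each action plus
  -- the change of potential is at most the surplus of the request; copies left at the end are worth
  -- at least zero.
  profit-bound : ∀ {B h n} {rs : Vec Request n} → 0# ≤ θ → (π : Plan B h rs) →
                 profit π ≤ h · θ + total (surplus θ) rs
  profit-bound {h = h} 0≤θ [] = +-nonNeg (·-nonNeg h 0≤θ) ≤-refl
  profit-bound {h = h} {rs = r@(request _ _ _ _) ∷ rs} 0≤θ (buy {b} _ refl ∷ π) = begin
    - b + profit π
      ≤⟨ +-monoʳ-≤ (- b) (profit-bound 0≤θ π) ⟩
    - b + (θ + h · θ + S)
      ≡⟨ solve 4 (λ b t k s → (:- b) :+ (t :+ k :+ s) := (t :- b) :+ (k :+ s)) refl b θ (h · θ) S ⟩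
    (θ - b) + (h · θ + S)
      ≤⟨ +-monoˡ-≤ (h · θ + S) (x≤posPart (θ - b)) ⟩
    buySurplus θ r + (h · θ + S)
      ≡⟨ +-identityˡ _ ⟨
    0# + (buySurplus θ r + (h · θ + S))
      ≤⟨ +-monoˡ-≤ _ (posPart-nonNeg (revenue r - θ)) ⟩
    sellSurplus θ r + (buySurplus θ r + (h · θ + S))
      ≡⟨ solve 4 (λ x y k s → x :+ (y :+ (k :+ s)) := k :+ ((x :+ y) :+ s)) refl
           (sellSurplus θ r) (buySurplus θ r) (h · θ) S ⟩
    h · θ + (surplus θ r + S) ∎
    where
    open ≤-Reasoning
    S = total (surplus θ) rs
  -- Selling requires a copy, so the `pred` in `after` really releases one copy priced at `θ`.
  profit-bound {h = suc h} {rs = r ∷ rs} 0≤θ (sell _ ∷ π) = begin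
    revenue r + profit π
      ≤⟨ +-monoʳ-≤ (revenue r) (profit-bound 0≤θ π) ⟩
    revenue r + (h · θ + S)
      ≡⟨ solve 4 (λ v t k s → v :+ (k :+ s) := (v :- t) :+ (t :+ k :+ s)) refl (revenue r) θ (h · θ) S ⟩
    (revenue r - θ) + (θ + h · θ + S)
      ≤⟨ +-monoˡ-≤ _ (x≤posPart (revenue r - θ)) ⟩
    sellSurplus θ r + (θ + h · θ + S)
      ≡⟨ +-identityˡ _ ⟨
    0# + (sellSurplus θ r + (θ + h · θ + S))
      ≤⟨ +-monoˡ-≤ _ (buySurplus-nonNeg θ r) ⟩
    buySurplus θ r + (sellSurplus θ r + (θ + h · θ + S))
      ≡⟨ solve 4 (λ x y k s → y :+ (x :+ (k :+ s)) := k :+ ((x :+ y) :+ s)) refl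
           (sellSurplus θ r) (buySurplus θ r) (θ + h · θ) S ⟩
    θ + h · θ + (surplus θ r + S) ∎
    where
    open ≤-Reasoning
    S = total (surplus θ) rs
  profit-bound {h = h} {rs = r ∷ rs} 0≤θ (skip ∷ π) = begin
    0# + profit π
      ≤⟨ +-mono-≤ (+-nonNeg (posPart-nonNeg (revenue r - θ)) (buySurplus-nonNeg θ r)) (profit-bound 0≤θ π) ⟩
    surplus θ r + (h · θ + S)
      ≡⟨ solve 3 (λ x k s → x :+ (k :+ s) := k :+ (x :+ s)) refl (surplus θ r) (h · θ) S ⟩
    h · θ + (surplus θ r + S) ∎
    where
    open ≤-Reasoning
    S = total (surplus θ) rs


-- The value of lazy threshold trading.

module LazyThresholdTrading {c ℓ} (F : OrderedField c ℓ) (θ : OrderedField.Carrier F)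
                            {B : ℕ} (1≤B : 1 ℕ.≤ B) where
  open OrderedField F
  open OrderedFieldProperties F
  open ATP F
  open Expectation F
  open ThresholdTrading F
  open MarkovStrategies F

  -- Nothing is bought while a copy is in hand, so from an inventory of at most one copy only the
  -- states 0 and 1 occur, and their two values determine each other recursively.
  trade : ∀ h r → Σ Action (Allowed B h r)
  trade zero (request ⊤⁺ _ _ _) = skip , skip
  trade zero (request [ b ] _ _ _) with b ≤? θ
  ... | yes _ = buy , buy 1≤B refl
  ... | no  _ = skip , skip
  trade (suc h) r with θ ≤? revenue r
  ... | yes _ = sell , sell (s≤s z≤n)
  ... | no  _ = skip , skip

  -- The indicator of a trade: its expectations `p` and `q` are the probabilities that `trade` sells
  -- when holding one copy and buys when empty-handed.
  turnover : Action → Carrier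
  turnover buy  = 1#
  turnover sell = 1#
  turnover skip = 0#

  0≤turnover : ∀ a → 0# ≤ turnover a
  0≤turnover buy  = 0≤1
  0≤turnover sell = 0≤1
  0≤turnover skip = ≤-refl

  turnover≤1 : ∀ a → turnover a ≤ 1#
  turnover≤1 buy  = ≤-refl
  turnover≤1 sell = ≤-refl
  turnover≤1 skip = 0≤1

  turnoverAt : ℕ → Request → Carrier
  turnoverAt h r = turnover (proj₁ (trade h r))

  module _ (V : ℕ → Carrier) where
    payoff : ∀ {h r} → Σ Action (Allowed B h r) → Carrier
    payoff {h} (a , m) = gain m + V (after h a)

    -- The amount by which `θ` exceeds `V 1 - V 0`, the marginal continuation value of a copy.
    gap : Carrier
    gap = θ + V 0 - V 1

    private
      no-trade : ∀ {u} x k → u ≡ 0# → 0# + x ≡ x + (u + 0# * k)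
      no-trade x k u≡0 = trans (+-comm 0# x)
        (cong (x +_) (sym (trans (cong₂ _+_ u≡0 (zeroˡ k)) (+-identityˡ 0#))))

    -- A sale moves the state from 1 to 0. Splitting its revenue into `θ` and the surplus leaves
    -- `gap` as the correction for pricing the copy at `θ`; without a sale the surplus vanishes. In
    -- `payoff-empty` the state moves the other way, hence the opposite sign.
    payoff-holding : ∀ r → payoff (trade 1 r) ≡ V 1 + (sellSurplus θ r + turnoverAt 1 r * gap)
    payoff-holding r with θ ≤? revenue r
    ... | no  θ≰s = no-trade (V 1) gap (x≤y⇒posPart≡0 (≰⇒≥ θ≰s))
    ... | yes θ≤s = sym (trans
      (cong (V 1 +_) (cong₂ _+_ (x≤y⇒posPart≡y-x θ≤s) (*-identityˡ gap)))
      (solve 4 (λ s t v w → w :+ ((s :- t) :+ (t :+ v :- w)) := s :+ v) refl (revenue r) θ (V 0) (V 1)))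

    payoff-empty : ∀ r → payoff (trade 0 r) ≡ V 0 + (buySurplus θ r + turnoverAt 0 r * - gap)
    payoff-empty (request ⊤⁺ _ _ _) = no-trade (V 0) (- gap) refl
    payoff-empty (request [ b ] _ _ _) with b ≤? θ
    ... | no  b≰θ = no-trade (V 0) (- gap) (x≤y⇒posPart≡0 (≰⇒≥ b≰θ))
    ... | yes b≤θ = sym (trans
      (cong (V 0 +_) (cong₂ _+_ (x≤y⇒posPart≡y-x b≤θ) (*-identityˡ (- gap))))
      (solve 4 (λ b t v w → v :+ ((t :- b) :+ (:- (t :+ v :- w))) := (:- b) :+ w) refl b θ (V 0) (V 1)))

  -- Idling half of the time makes the probability of being empty-handed
  -- nondecreasing in time; without it the inventory could oscillate.
  lazyTrade : Strategy B
  lazyTrade h r = fairCoin (skip , skip) (trade h r)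

  module _ (D : FiniteDistribution Request) where
    V : ℕ → ℕ → Carrier
    V = value lazyTrade D

    -- Serves both states, with `u` the surplus and `k` plus or minus the gap. The idle half of the
    -- coin returns `V n h`, so only half of the increment remains.
    V-suc : ∀ n h u k → (∀ r → payoff (V n) (trade h r) ≡ V n h + (u r + turnoverAt h r * k)) →
            V (suc n) h ≡ V n h + ½ * (𝔼 D u + 𝔼 D (turnoverAt h) * k)
    V-suc n h u k payoff≡ = begin
      𝔼 D (λ r → 𝔼 (lazyTrade h r) (payoff (V n)))
        ≡⟨ 𝔼-cong D (λ r → trans (𝔼-fairCoin (skip , skip) (trade h r) (payoff (V n))) (halves r)) ⟩
      𝔼 D (λ r → V n h + (u r + turnoverAt h r * k) * ½)
        ≡⟨ 𝔼-const-+ D (V n h) (λ r → (u r + turnoverAt h r * k) * ½) ⟩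
      V n h + 𝔼 D (λ r → (u r + turnoverAt h r * k) * ½)
        ≡⟨ cong (V n h +_) (trans (𝔼-*ʳ D (λ r → u r + turnoverAt h r * k) ½) (*-comm _ ½)) ⟩
      V n h + ½ * 𝔼 D (λ r → u r + turnoverAt h r * k)
        ≡⟨ cong (λ e → V n h + ½ * e) (trans (𝔼-+ D u (λ r → turnoverAt h r * k))
             (cong (𝔼 D u +_) (𝔼-*ʳ D (turnoverAt h) k))) ⟩
      V n h + ½ * (𝔼 D u + 𝔼 D (turnoverAt h) * k) ∎
      where
      open ≡-Reasoning
      halves : ∀ r → ½ * (0# + V n h) + ½ * payoff (V n) (trade h r) ≡
                     V n h + (u r + turnoverAt h r * k) * ½
      halves r = begin
        ½ * (0# + V n h) + ½ * payoff (V n) (trade h r)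
          ≡⟨ cong₂ (λ x y → ½ * x + ½ * y) (+-identityˡ (V n h)) (payoff≡ r) ⟩
        ½ * V n h + ½ * (V n h + (u r + turnoverAt h r * k))
          ≡⟨ solve 3 (λ i v w → i :* v :+ i :* (v :+ w) := (i :* v :+ i :* v) :+ w :* i) refl
               ½ (V n h) (u r + turnoverAt h r * k) ⟩
        (½ * V n h + ½ * V n h) + (u r + turnoverAt h r * k) * ½
          ≡⟨ cong (_+ (u r + turnoverAt h r * k) * ½) (½x+½x≡x (V n h)) ⟩
        V n h + (u r + turnoverAt h r * k) * ½ ∎

    S C p q : Carrier
    S = 𝔼 D (sellSurplus θ)
    C = 𝔼 D (buySurplus θ)
    p = 𝔼 D (turnoverAt 1)
    q = 𝔼 D (turnoverAt 0)

    -- Through `V-holding`, `½ * (p * totalGap n)` is the excess of `V n 1` over `½ * n · S`, so the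
    -- target bound reduces to nonnegativity of this sum.
    totalGap : ℕ → Carrier
    totalGap zero    = 0#
    totalGap (suc n) = totalGap n + gap (V n)

    V-holding : ∀ n → V n 1 ≡ ½ * (n · S + p * totalGap n)
    V-holding zero    = sym (trans (cong (½ *_) (trans (+-identityˡ _) (zeroʳ p))) (zeroʳ ½))
    V-holding (suc n) = begin
      V (suc n) 1
        ≡⟨ V-suc n 1 (sellSurplus θ) (gap (V n)) (payoff-holding (V n)) ⟩
      V n 1 + ½ * (S + p * gap (V n))
        ≡⟨ cong (_+ ½ * (S + p * gap (V n))) (V-holding n) ⟩
      ½ * (n · S + p * totalGap n) + ½ * (S + p * gap (V n))
        ≡⟨ solve 6 (λ i a s p t g → i :* (a :+ p :* t) :+ i :* (s :+ p :* g) :=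
             i :* (s :+ a :+ p :* (t :+ g))) refl ½ (n · S) S p (totalGap n) (gap (V n)) ⟩
      ½ * (S + n · S + p * (totalGap n + gap (V n))) ∎
      where open ≡-Reasoning

    V-empty : ∀ n → V n 0 ≡ ½ * (n · C - q * totalGap n)
    V-empty zero    = sym (trans
      (cong (½ *_) (trans (cong (λ x → 0# - x) (zeroʳ q)) (-‿inverseʳ 0#))) (zeroʳ ½))
    V-empty (suc n) = begin
      V (suc n) 0
        ≡⟨ V-suc n 0 (buySurplus θ) (- gap (V n)) (payoff-empty (V n)) ⟩
      V n 0 + ½ * (C + q * - gap (V n))
        ≡⟨ cong (_+ ½ * (C + q * - gap (V n))) (V-empty n) ⟩
      ½ * (n · C - q * totalGap n) + ½ * (C + q * - gap (V n))
        ≡⟨ solve 6 (λ i a s q t g → i :* (a :- q :* t) :+ i :* (s :+ q :* (:- g)) :=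
             i :* (s :+ a :- q :* (t :+ g))) refl ½ (n · C) C q (totalGap n) (gap (V n)) ⟩
      ½ * (C + n · C - q * (totalGap n + gap (V n))) ∎
      where open ≡-Reasoning

    0≤p : 0# ≤ p
    0≤p = 0≤𝔼 D _ λ r → 0≤turnover (proj₁ (trade 1 r))

    0≤1-𝔼turnover : ∀ h → 0# ≤ 1# - 𝔼 D (turnoverAt h)
    0≤1-𝔼turnover h = x≤y⇒0≤y-x (subst (𝔼 D (turnoverAt h) ≤_) (𝔼-const D 1#)
      (𝔼-mono D λ r → turnover≤1 (proj₁ (trade h r))))

    module _ (T : ℕ) (0≤θ : 0# ≤ θ) (balanced : T · S ≡ θ + T · C) where
      -- Balance says `T · (S - C) ≡ θ` with `θ` nonnegative, so the multiple for fewer steps is at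
      -- most `θ`.
      n·S≤θ+n·C : ∀ {n} → n ℕ.≤ T → n · S ≤ θ + n · C
      n·S≤θ+n·C {n} n≤T = begin
        n · S                  ≡⟨ split n ⟩
        n · (S - C) + n · C    ≤⟨ +-monoˡ-≤ (n · C) (·-prefix-≤ n≤T (subst (0# ≤_) (sym T·[S-C]≡θ) 0≤θ)) ⟩
        T · (S - C) + n · C    ≡⟨ cong (_+ n · C) T·[S-C]≡θ ⟩
        θ + n · C              ∎
        where
        open ≤-Reasoning
        split : ∀ n → n · S ≡ n · (S - C) + n · C
        split n = trans (cong (n ·_) (solve 2 (λ s c → s := s :- c :+ c) refl S C))
          (·-distrib-+ (S - C) C n)

        T·[S-C]≡θ : T · (S - C) ≡ θ
        T·[S-C]≡θ = trans (solve 2 (λ x y → x := x :+ y :- y) refl (T · (S - C)) (T · C))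
          (trans (cong (_- T · C) (trans (sym (split T)) balanced))
            (solve 2 (λ x y → x :+ y :- y := x) refl θ (T · C)))

      -- Substituting `V-empty` and `V-holding` into the new gap gives a linear recursion for
      -- `totalGap`. Its coefficient is the average of `1# - p` and `1# - q`, nonnegative thanks to
      -- the halving of trades by the coin.
      totalGap-suc : ∀ n → totalGap (suc n) ≡
        ½ * (θ + (θ + n · C - n · S)) + ½ * (((1# - p) + (1# - q)) * totalGap n)
      totalGap-suc n = begin
        G + (θ + V n 0 - V n 1)
          ≡⟨ cong₂ (λ x y → G + (θ + x - y)) (V-empty n) (V-holding n) ⟩
        G + (θ + ½ * (n · C - q * G) - ½ * (n · S + p * G))
          -- `G` and `θ` are split into halves so that every term carries the opaque factor `½` and
          -- the solver can collect them.
          ≡⟨ cong₂ (λ x y → x + (y + ½ * (n · C - q * G) - ½ * (n · S + p * G))) one*G (sym (½x+½x≡x θ)) ⟩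
        (½ * (1# * G) + ½ * (1# * G)) + (½ * θ + ½ * θ + ½ * (n · C - q * G) - ½ * (n · S + p * G))
          ≡⟨ solve 8 (λ i u G t c s p q →
               (i :* (u :* G) :+ i :* (u :* G)) :+
                 (i :* t :+ i :* t :+ i :* (c :- q :* G) :- i :* (s :+ p :* G)) :=
               i :* (t :+ (t :+ c :- s)) :+ i :* (((u :- p) :+ (u :- q)) :* G)) refl
               ½ 1# G θ (n · C) (n · S) p q ⟩
        ½ * (θ + (θ + n · C - n · S)) + ½ * (((1# - p) + (1# - q)) * G) ∎
        where
        open ≡-Reasoning
        G = totalGap n
        one*G : G ≡ ½ * (1# * G) + ½ * (1# * G)
        one*G = trans (sym (*-identityˡ G)) (sym (½x+½x≡x (1# * G)))

      -- Induction along the recursion: the inhomogeneous term is nonnegative by `n·S≤θ+n·C`, which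
      -- confines the claim to `n ℕ.≤ T`.
      0≤totalGap : ∀ {n} → n ℕ.≤ T → 0# ≤ totalGap n
      0≤totalGap {zero}  _   = ≤-refl
      0≤totalGap {suc n} n<T = subst (0# ≤_) (sym (totalGap-suc n)) (+-nonNeg
        (*-nonNeg 0≤½ (+-nonNeg 0≤θ (x≤y⇒0≤y-x (n·S≤θ+n·C n≤T))))
        (*-nonNeg 0≤½ (*-nonNeg (+-nonNeg (0≤1-𝔼turnover 1) (0≤1-𝔼turnover 0)) (0≤totalGap n≤T))))
        where n≤T = ℕ.<⇒≤ n<T

      ½T·S≤V : ½ * T · S ≤ V T 1
      ½T·S≤V = subst (½ * T · S ≤_) (sym (V-holding T)) (*-monoˡ-≤ 0≤½
        (subst (_≤ T · S + p * totalGap T) (+-identityʳ (T · S))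
          (+-monoʳ-≤ (T · S) (*-nonNeg 0≤p (0≤totalGap ℕ.≤-refl)))))

-- Comparison of the offline bound with the online value.

theorem1p3 : ∀ {c ℓ} (F : OrderedField c ℓ) →
    let open OrderedField F
        open ATP F
    in
    (I : Instance) (D : FiniteDistribution Request) →
    Instance.requests I ≡ replicate (Instance.horizon I) D →
    Instance.initial I ≡ 1 →
    Instance.capacity I ≡ 1 →
    ∃ λ (α : OnlineAlgorithm I) → (ω : OptimalOfflineAlgorithm I) →
      ¼ * expectedOfflineProfit I ω ≤ expectedOnlineProfit I α
theorem1p3 F I@record { horizon = T ; 1≤capacity = 1≤B } D refl refl _ =
  let θ , 0≤θ , balanced = balanced-threshold D T
      open OfflineBound F θ
      open LazyThresholdTrading F θ 1≤B
  in (λ η → lazyTrade (held 1 η)) , λ ω → begin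
    ¼ * expectedOfflineProfit I ω
      ≤⟨ *-monoˡ-≤ 0≤¼ (𝔼-indep-mono (replicate T D) λ rs →
           profit-bound 0≤θ (OptimalOfflineAlgorithm.plan ω rs)) ⟩
    -- `θ + 0#` is the unfolded `1 · θ`, the price of the initial copy.
    ¼ * 𝔼-indep (replicate T D) (λ rs → (θ + 0#) + total (surplus θ) rs)
      ≡⟨ cong (¼ *_) (offline-value θ balanced) ⟩
    ¼ * (T · 𝔼 D (sellSurplus θ) + T · 𝔼 D (sellSurplus θ))
      ≡⟨ ¼[x+x]≡½x _ ⟩
    ½ * T · 𝔼 D (sellSurplus θ)
      ≤⟨ ½T·S≤V D T 0≤θ balanced ⟩
    value lazyTrade D T 1
      ≡⟨ 𝔼-onlineProfit I lazyTrade D T [] ⟨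
    expectedOnlineProfit I (λ η → lazyTrade (held 1 η)) ∎
  where
  open OrderedField F
  open OrderedFieldProperties F
  open ATP F
  open Expectation F
  open ThresholdTrading F
  open MarkovStrategies F
  open ≤-Reasoning

  offline-value : ∀ θ → T · 𝔼 D (sellSurplus θ) ≡ θ + T · 𝔼 D (buySurplus θ) →
    𝔼-indep (replicate T D) (λ rs → (θ + 0#) + total (surplus θ) rs) ≡
    T · 𝔼 D (sellSurplus θ) + T · 𝔼 D (sellSurplus θ)
  offline-value θ balanced =
    trans (𝔼-indep-const-+ (replicate T D) (θ + 0#) (total (surplus θ)))
    (trans (cong₂ _+_ (+-identityʳ θ) (trans (𝔼-indep-total T D (surplus θ))
      (trans (cong (T ·_) (𝔼-+ D (sellSurplus θ) (buySurplus θ)))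
        (·-distrib-+ (𝔼 D (sellSurplus θ)) (𝔼 D (buySurplus θ)) T))))
    -- Regrouping `θ` with the buying part exposes the right-hand side of `balanced`, which becomes
    -- a second copy of the selling part.
    (trans (solve 3 (λ t s c → t :+ (s :+ c) := s :+ (t :+ c)) refl
        θ (T · 𝔼 D (sellSurplus θ)) (T · 𝔼 D (buySurplus θ)))
      (cong (T · 𝔼 D (sellSurplus θ) +_) (sym balanced))))
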